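{- Let $\alpha \geq 0.28866$. Then every digraph $G$ on $n \ge 1$ vertices (without loops or parallel arcs) in which every vertex has outdegree at least $\alpha n$ contains a directed cycle of length at most $4$.
   Context: A digraph here has no loops and no parallel arcs, i.e. at most one arc $(u,v)$ for each ordered pair of distinct vertices; the two arcs $(u,v)$ and $(v,u)$ may both be present, and they form a directed cycle of length $2$. -}

module Defs where

import Algebra.Properties.Group as GroupProperties
import Algebra.Properties.Ring as RingProperties
open import Data.Fin using (Fin; toℕ)
open import Data.Fin.Subset using (Subset; _∈_; _∉_; ∣_∣)
open import Data.Integer using (+_)
open import Data.Nat as ℕ using (ℕ; suc; NonZero; _⊔_)
import Data.Nat.Properties as ℕₚ
open import Data.Nat.DivMod using (_mod_)
open import Data.Product using (Σ-syntax; ∃-syntax; _×_; _,_)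
open import Data.Rational as ℚ using (ℚ; 0ℚ; 1ℚ)
import Data.Rational.Properties as ℚₚ
open import Function.Definitions using (Injective)
open import Relation.Binary.PropositionalEquality

------------------------------------------------------------------------
-- Real numbers, as Cauchy sequences of rationals.  No quotient is taken:
-- x and y denote the same real number when x ≤ᴿ y and y ≤ᴿ x.

Cauchy : (ℕ → ℚ) → Set
Cauchy x = ∀ ε → 0ℚ ℚ.< ε →
  ∃[ N ] (∀ i j → N ℕ.≤ i → N ℕ.≤ j → ℚ.∣ x i ℚ.- x j ∣ ℚ.< ε)

record ℝ : Set where
  constructor mkℝ
  field
    seq    : ℕ → ℚ
    cauchy : Cauchy seq

open ℝ public

infix 4 _≤ᴿ_

_≤ᴿ_ : ℝ → ℝ → Set
x ≤ᴿ y = ∀ ε → 0ℚ ℚ.< ε → ∃[ N ] (∀ i → N ℕ.≤ i → seq x i ℚ.≤ seq y i ℚ.+ ε)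

fromℚ : ℚ → ℝ
fromℚ q = mkℝ (λ _ → q) λ ε 0<ε →
  0 , λ _ _ _ _ → subst (ℚ._< ε) (sym (cong ℚ.∣_∣ (ℚₚ.+-inverseʳ q))) 0<ε

fromℕ : ℕ → ℝ
fromℕ n = fromℚ (+ n ℚ./ 1)

private
  EventuallyBounded : (ℕ → ℚ) → Set
  EventuallyBounded x =
    Σ[ B ∈ ℚ ] (ℚ.Positive B × ∃[ N ] (∀ i → N ℕ.≤ i → ℚ.∣ x i ∣ ℚ.< B))

  telescope : ∀ p q r → (p ℚ.- q) ℚ.+ (q ℚ.- r) ≡ p ℚ.- r
  telescope p q r = begin
    (p ℚ.- q) ℚ.+ (q ℚ.- r)       ≡⟨ ℚₚ.+-assoc p (ℚ.- q) (q ℚ.- r) ⟩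
    p ℚ.+ (ℚ.- q ℚ.+ (q ℚ.- r))   ≡⟨ cong (p ℚ.+_) (\\-leftDividesʳ q (ℚ.- r)) ⟩
    p ℚ.- r                       ∎
    where
    open ≡-Reasoning
    open GroupProperties ℚₚ.+-0-group using (\\-leftDividesʳ)

  restore : ∀ p q → q ℚ.+ (p ℚ.- q) ≡ p
  restore p q = begin
    q ℚ.+ (p ℚ.- q)   ≡⟨ ℚₚ.+-comm q (p ℚ.- q) ⟩
    (p ℚ.- q) ℚ.+ q   ≡⟨ //-rightDividesˡ q p ⟩
    p                 ∎
    where
    open ≡-Reasoning
    open GroupProperties ℚₚ.+-0-group using (//-rightDividesˡ)

  *-difference : ∀ a b c d →
    a ℚ.* b ℚ.- c ℚ.* d ≡ a ℚ.* (b ℚ.- d) ℚ.+ (a ℚ.- c) ℚ.* d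
  *-difference a b c d = sym (begin
    a ℚ.* (b ℚ.- d) ℚ.+ (a ℚ.- c) ℚ.* d
      ≡⟨ cong₂ ℚ._+_ (x[y-z]≈xy-xz a b d) ([y-z]x≈yx-zx d a c) ⟩
    (a ℚ.* b ℚ.- a ℚ.* d) ℚ.+ (a ℚ.* d ℚ.- c ℚ.* d)
      ≡⟨ telescope (a ℚ.* b) (a ℚ.* d) (c ℚ.* d) ⟩
    a ℚ.* b ℚ.- c ℚ.* d
      ∎)
    where
    open ≡-Reasoning
    open RingProperties ℚₚ.+-*-ring using (x[y-z]≈xy-xz; [y-z]x≈yx-zx)

  bounded : ∀ {x} → Cauchy x → EventuallyBounded x
  bounded {x} cx with cx 1ℚ (ℚₚ.positive⁻¹ 1ℚ)
  ... | N , h = ℚ.∣ x N ∣ ℚ.+ 1ℚ , pos , N , bnd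
    where
    pos : ℚ.Positive (ℚ.∣ x N ∣ ℚ.+ 1ℚ)
    pos = ℚₚ.nonNeg+pos⇒pos ℚ.∣ x N ∣ {{ℚ.nonNegative (ℚₚ.0≤∣p∣ (x N))}} 1ℚ

    bnd : ∀ i → N ℕ.≤ i → ℚ.∣ x i ∣ ℚ.< ℚ.∣ x N ∣ ℚ.+ 1ℚ
    bnd i N≤i = begin-strict
      ℚ.∣ x i ∣                            ≡⟨ cong ℚ.∣_∣ (sym (restore (x i) (x N))) ⟩
      ℚ.∣ x N ℚ.+ (x i ℚ.- x N) ∣          ≤⟨ ℚₚ.∣p+q∣≤∣p∣+∣q∣ (x N) _ ⟩
      ℚ.∣ x N ∣ ℚ.+ ℚ.∣ x i ℚ.- x N ∣      <⟨ ℚₚ.+-monoʳ-< ℚ.∣ x N ∣ (h i N N≤i ℕₚ.≤-refl) ⟩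
      ℚ.∣ x N ∣ ℚ.+ 1ℚ                     ∎
      where open ℚₚ.≤-Reasoning

  *-cauchy : ∀ x y → Cauchy x → Cauchy y → Cauchy (λ i → x i ℚ.* y i)
  *-cauchy x y cx cy ε 0<ε with bounded cx | bounded cy
  ... | B , B>0 , M , hB | C , C>0 , K , hC = go
    where
    instance
      B⁺ : ℚ.Positive B
      B⁺ = B>0
      C⁺ : ℚ.Positive C
      C⁺ = C>0

    S : ℚ
    S = B ℚ.+ C

    instance
      S⁺ : ℚ.Positive S
      S⁺ = ℚₚ.pos+pos⇒pos B C
      S≢0 : ℚ.NonZero S
      S≢0 = ℚₚ.pos⇒nonZero S
      1/S⁺ : ℚ.Positive (ℚ.1/ S)
      1/S⁺ = ℚₚ.1/pos⇒pos S
      ε⁺ : ℚ.Positive ε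
      ε⁺ = ℚ.positive 0<ε

    δ : ℚ
    δ = ε ℚ.* ℚ.1/ S

    instance
      δ⁺ : ℚ.Positive δ
      δ⁺ = ℚₚ.pos*pos⇒pos ε (ℚ.1/ S)

    product-< : ∀ p q {b d} .{{_ : ℚ.Positive b}} →
                ℚ.∣ p ∣ ℚ.< b → ℚ.∣ q ∣ ℚ.< d → ℚ.∣ p ℚ.* q ∣ ℚ.< b ℚ.* d
    product-< p q {b} {d} p<b q<d = begin-strict
      ℚ.∣ p ℚ.* q ∣         ≡⟨ ℚₚ.∣p*q∣≡∣p∣*∣q∣ p q ⟩
      ℚ.∣ p ∣ ℚ.* ℚ.∣ q ∣   ≤⟨ ℚₚ.*-monoʳ-≤-nonNeg ℚ.∣ q ∣
                                 {{ℚ.nonNegative (ℚₚ.0≤∣p∣ q)}} (ℚₚ.<⇒≤ p<b) ⟩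
      b ℚ.* ℚ.∣ q ∣         <⟨ ℚₚ.*-monoʳ-<-pos b q<d ⟩
      b ℚ.* d               ∎
      where open ℚₚ.≤-Reasoning

    go : ∃[ N ] (∀ i j → N ℕ.≤ i → N ℕ.≤ j →
                 ℚ.∣ x i ℚ.* y i ℚ.- x j ℚ.* y j ∣ ℚ.< ε)
    go with cx δ (ℚₚ.positive⁻¹ δ) | cy δ (ℚₚ.positive⁻¹ δ)
    ... | P , hx | Q , hy = (M ⊔ K) ⊔ (P ⊔ Q) , close
      where
      close : ∀ i j → (M ⊔ K) ⊔ (P ⊔ Q) ℕ.≤ i → (M ⊔ K) ⊔ (P ⊔ Q) ℕ.≤ j →
              ℚ.∣ x i ℚ.* y i ℚ.- x j ℚ.* y j ∣ ℚ.< ε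
      close i j N≤i N≤j = begin-strict
        ℚ.∣ x i ℚ.* y i ℚ.- x j ℚ.* y j ∣
          ≡⟨ cong ℚ.∣_∣ (*-difference (x i) (y i) (x j) (y j)) ⟩
        ℚ.∣ x i ℚ.* (y i ℚ.- y j) ℚ.+ (x i ℚ.- x j) ℚ.* y j ∣
          ≤⟨ ℚₚ.∣p+q∣≤∣p∣+∣q∣ (x i ℚ.* (y i ℚ.- y j)) _ ⟩
        ℚ.∣ x i ℚ.* (y i ℚ.- y j) ∣ ℚ.+ ℚ.∣ (x i ℚ.- x j) ℚ.* y j ∣
          <⟨ ℚₚ.+-mono-<
               (product-< (x i) (y i ℚ.- y j) (hB i (M≤ N≤i)) (hy i j (Q≤ N≤i) (Q≤ N≤j)))
               (product-< (x i ℚ.- x j) (y j) (hx i j (P≤ N≤i) (P≤ N≤j)) (hC j (K≤ N≤j))) ⟩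
        B ℚ.* δ ℚ.+ δ ℚ.* C
          ≡⟨ cong (ℚ._+ δ ℚ.* C) (ℚₚ.*-comm B δ) ⟩
        δ ℚ.* B ℚ.+ δ ℚ.* C
          ≡⟨ ℚₚ.*-distribˡ-+ δ B C ⟨
        δ ℚ.* S
          ≡⟨ ℚₚ.*-assoc ε (ℚ.1/ S) S ⟩
        ε ℚ.* (ℚ.1/ S ℚ.* S)
          ≡⟨ cong (ε ℚ.*_) (ℚₚ.*-inverseˡ S) ⟩
        ε ℚ.* 1ℚ
          ≡⟨ ℚₚ.*-identityʳ ε ⟩
        ε ∎
        where
        open ℚₚ.≤-Reasoning
        M≤ : ∀ {k} → (M ⊔ K) ⊔ (P ⊔ Q) ℕ.≤ k → M ℕ.≤ k
        M≤ h = ℕₚ.m⊔n≤o⇒m≤o M K (ℕₚ.m⊔n≤o⇒m≤o (M ⊔ K) (P ⊔ Q) h)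
        K≤ : ∀ {k} → (M ⊔ K) ⊔ (P ⊔ Q) ℕ.≤ k → K ℕ.≤ k
        K≤ h = ℕₚ.m⊔n≤o⇒n≤o M K (ℕₚ.m⊔n≤o⇒m≤o (M ⊔ K) (P ⊔ Q) h)
        P≤ : ∀ {k} → (M ⊔ K) ⊔ (P ⊔ Q) ℕ.≤ k → P ℕ.≤ k
        P≤ h = ℕₚ.m⊔n≤o⇒m≤o P Q (ℕₚ.m⊔n≤o⇒n≤o (M ⊔ K) (P ⊔ Q) h)
        Q≤ : ∀ {k} → (M ⊔ K) ⊔ (P ⊔ Q) ℕ.≤ k → Q ℕ.≤ k
        Q≤ h = ℕₚ.m⊔n≤o⇒n≤o P Q (ℕₚ.m⊔n≤o⇒n≤o (M ⊔ K) (P ⊔ Q) h)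

infixl 7 _*ᴿ_

_*ᴿ_ : ℝ → ℝ → ℝ
x *ᴿ y = mkℝ (λ i → seq x i ℚ.* seq y i) (*-cauchy (seq x) (seq y) (cauchy x) (cauchy y))

------------------------------------------------------------------------
-- Digraphs on the vertex set Fin n.  Out-neighbourhoods are subsets, so
-- there is at most one arc for each ordered pair of vertices.

record Digraph (n : ℕ) : Set where
  field
    out      : Fin n → Subset n
    loopless : ∀ v → v ∉ out v

  infix 4 _⟶_

  _⟶_ : Fin n → Fin n → Set
  u ⟶ v = v ∈ out u

  outdegree : Fin n → ℕ
  outdegree v = ∣ out v ∣

-- Indices are read modulo the length, so the last vertex has an arc to the
-- first.  Length 1 needs no explicit exclusion: it would be a loop.
record DirectedCycle {n} (G : Digraph n) (length : ℕ) : Set where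
  open Digraph G
  field
    {{nonZero}} : NonZero length
    vertex      : Fin length → Fin n
    distinct    : Injective _≡_ _≡_ vertex
    arc         : ∀ i → vertex i ⟶ vertex (suc (toℕ i) mod length)

{-# OPTIONS --safe #-}

-- By strong induction on the size of H, every nonempty vertex set H contains a
-- vertex with fewer than a|H| outneighbours in H, where a = 0.28866 = p / q and
-- s = q - p.  Otherwise trim the arcs inside H so that every outdegree is r ≥ a|H|,
-- write N⁺ and N⁻ for the neighbourhoods, and let u → v be an arc with t common
-- outneighbours.  By induction there are
--   w in N⁺(u) ∩ N⁺(v) such that A = N⁺(v) ∪ N⁺(w) has at least r + (1 - a)t vertices
--     (if t = 0, take A = N⁺(v)),
--   x in A such that S = A ∪ N⁺(x) has at least (1 - a)|A| + r vertices,
-- and S avoids N⁻(u) ∪ N⁻(v), since an arc back would close a walk of length at most 4.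
-- Summing |S| + |N⁻(u) ∪ N⁻(v)| ≤ |H| over all arcs, common outneighbours and common
-- inneighbours both count transitive triangles, of which there are at most |H|r²/2,
-- and one gets a(4 - 2a + a²/2) ≤ 1, which just fails at a = 0.28866.

module Submission where

open import Defs
open import Data.Fin using (Fin)
open import Data.Integer using (+_)
open import Data.Nat using (ℕ; _≤_)
open import Data.Product using (∃-syntax; _×_)
open import Data.Rational using (_/_)

import Data.Bool as 𝔹
import Data.Fin as Fin
import Data.Integer as ℤ
import Data.Integer.Properties as ℤₚ
import Data.Nat as ℕ
import Data.Rational as ℚ
import Data.Rational.Properties as ℚₚ
import Data.Rational.Unnormalised as ℚᵘ
import Data.Rational.Unnormalised.Properties as ℚᵘₚ
open import Data.Bool using (Bool; true; false; _∧_; _∨_)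
open import Data.Empty using (⊥; ⊥-elim)
open import Data.Fin.Properties using (any?)
open import Data.Fin.Subset using (Subset; ∣_∣)
open import Data.Nat using (zero; suc; _+_; _*_; _<_; _⊔_; z≤n; s≤s; s≤s⁻¹; NonZero; >-nonZero)
open import Data.Nat.DivMod using (_%_; m≡m%n+[m/n]*n; m%n<n; m<n*o⇒m/o<n)
open import Data.Nat.Properties
open import Data.Nat.Tactic.RingSolver using (solve-∀)
open import Data.Product using (_,_; proj₁; proj₂)
open import Data.Sum using (_⊎_; inj₁; inj₂)
open import Data.Unit using (tt)
open import Data.Vec using ([]; _∷_; lookup)
open import Data.Vec.Properties using (lookup⇒[]=)
open import Data.Vec.Relation.Unary.All using ([]; _∷_)
open import Data.Vec.Relation.Unary.AllPairs using ([]; _∷_)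
open import Data.Vec.Relation.Unary.Unique.Propositional.Properties using (lookup-injective)
open import Function using (_∘_)
open import Relation.Binary.PropositionalEquality
open import Relation.Nullary using (yes; no)
open import Relation.Nullary.Decidable using (_×-dec_)

open import Algebra.Properties.Semiring.Sum +-*-semiring
  using (sum; sum-syntax; sum-cong-≗; ∑-distrib-+; ∑-comm; *-distribˡ-sum; *-distribʳ-sum)

sum-mono-≤ : ∀ {n} {f g : Fin n → ℕ} → (∀ i → f i ≤ g i) → sum f ≤ sum g
sum-mono-≤ {zero}  f≤g = z≤n
sum-mono-≤ {suc n} f≤g = +-mono-≤ (f≤g Fin.zero) (sum-mono-≤ (f≤g ∘ Fin.suc))

-- Subsets and their cardinality

private
  variable
    n : ℕ

-- With Boolean-valued functions, sizes are sums of 0/1 terms, and double counting becomes an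
-- exchange of finite sums.
PSet : ℕ → Set
PSet n = Fin n → Bool

𝟙 : Bool → ℕ
𝟙 true  = 1
𝟙 false = 0

# : PSet n → ℕ
# A = sum (𝟙 ∘ A)

infix 4 _∈_ _⊆_
infixr 7 _∩_
infixr 6 _∪_

_∈_ : Fin n → PSet n → Set
x ∈ A = A x ≡ true

_⊆_ : PSet n → PSet n → Set
A ⊆ B = ∀ x → x ∈ A → x ∈ B

_∪_ _∩_ : PSet n → PSet n → PSet n
(A ∪ B) x = A x ∨ B x
(A ∩ B) x = A x ∧ B x

∈-∩⁻ : ∀ (A B : PSet n) x → x ∈ A ∩ B → x ∈ A × x ∈ B
∈-∩⁻ A B x h with A x | B x
... | true | true = refl , refl

∈-∩⁺ : ∀ (A B : PSet n) x → x ∈ A → x ∈ B → x ∈ A ∩ B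
∈-∩⁺ A B x a b rewrite a | b = refl

∈-∪⁻ : ∀ (A B : PSet n) x → x ∈ A ∪ B → x ∈ A ⊎ x ∈ B
∈-∪⁻ A B x h with A x
... | true  = inj₁ refl
... | false = inj₂ h

p⊆p∪q : ∀ (A B : PSet n) → A ⊆ A ∪ B
p⊆p∪q A B x a rewrite a = refl

𝟙-mono : ∀ a b → (a ≡ true → b ≡ true) → 𝟙 a ≤ 𝟙 b
𝟙-mono false b h = z≤n
𝟙-mono true  b h rewrite h refl = ≤-refl

𝟙-∧ : ∀ a b → 𝟙 (a ∧ b) ≡ 𝟙 a * 𝟙 b
𝟙-∧ true  b = sym (*-identityˡ (𝟙 b))
𝟙-∧ false b = refl

#-mono : {A B : PSet n} → A ⊆ B → # A ≤ # B
#-mono {A = A} {B} A⊆B = sum-mono-≤ λ x → 𝟙-mono (A x) (B x) (A⊆B x)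

#-∪-∩ : ∀ (A B : PSet n) → # (A ∪ B) + # (A ∩ B) ≡ # A + # B
#-∪-∩ A B = begin
  # (A ∪ B) + # (A ∩ B)                         ≡⟨ ∑-distrib-+ (𝟙 ∘ (A ∪ B)) (𝟙 ∘ (A ∩ B)) ⟨
  sum (λ x → 𝟙 (A x ∨ B x) + 𝟙 (A x ∧ B x))     ≡⟨ sum-cong-≗ (λ x → pointwise (A x) (B x)) ⟩
  sum (λ x → 𝟙 (A x) + 𝟙 (B x))                 ≡⟨ ∑-distrib-+ (𝟙 ∘ A) (𝟙 ∘ B) ⟩
  # A + # B                                     ∎
  where
  open ≡-Reasoning
  pointwise : ∀ a b → 𝟙 (a ∨ b) + 𝟙 (a ∧ b) ≡ 𝟙 a + 𝟙 b
  pointwise true  b = refl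
  pointwise false b = +-identityʳ (𝟙 b)

#-disjoint : {A B C : PSet n} → A ⊆ C → B ⊆ C → (∀ x → x ∈ A → x ∈ B → ⊥) → # A + # B ≤ # C
#-disjoint {A = A} {B} {C} A⊆C B⊆C disjoint = begin
  # A + # B                        ≡⟨ ∑-distrib-+ (𝟙 ∘ A) (𝟙 ∘ B) ⟨
  sum (λ x → 𝟙 (A x) + 𝟙 (B x))    ≤⟨ sum-mono-≤ (λ x → pointwise (A⊆C x) (B⊆C x) (disjoint x)) ⟩
  # C                              ∎
  where
  open ≤-Reasoning
  pointwise : ∀ {a b c} → (a ≡ true → c ≡ true) → (b ≡ true → c ≡ true) →
              (a ≡ true → b ≡ true → ⊥) → 𝟙 a + 𝟙 b ≤ 𝟙 c
  pointwise {true}  {true}  ac bc ab = ⊥-elim (ab refl refl)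
  pointwise {true}  {false} ac bc ab rewrite ac refl = ≤-refl
  pointwise {false} {b} {c} ac bc ab = 𝟙-mono b c bc

#-strict-mono : {A B : PSet n} → A ⊆ B → ∀ y → y ∈ B → (y ∈ A → ⊥) → # A < # B
#-strict-mono {A = A} {B} A⊆B Fin.zero y∈B y∉A = +-mono-<-≤ (head (A Fin.zero) y∈B y∉A) (#-mono (A⊆B ∘ Fin.suc))
  where
  head : ∀ a {b} → b ≡ true → (a ≡ true → ⊥) → 𝟙 a < 𝟙 b
  head true  b∈ a∉ = ⊥-elim (a∉ refl)
  head false refl a∉ = ≤-refl
#-strict-mono {A = A} {B} A⊆B (Fin.suc y) y∈B y∉A =
  +-mono-≤-< (𝟙-mono (A Fin.zero) (B Fin.zero) (A⊆B Fin.zero))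
             (#-strict-mono (A⊆B ∘ Fin.suc) y y∈B y∉A)

-- Keeps the first `k` elements of `B` in index order. It serves to cut all outneighbourhoods down
-- to a common size.
shrink : ∀ (B : PSet n) k → k ≤ # B → ∃[ C ] (C ⊆ B × # C ≡ k)
shrink {zero}  B zero    k≤ = B , (λ x x∈ → x∈) , refl
shrink {suc n} B k k≤ with B Fin.zero in eq
shrink {suc n} B zero k≤ | true with shrink (B ∘ Fin.suc) zero z≤n
... | C , C⊆B , #C = (λ { Fin.zero → false ; (Fin.suc x) → C x }) , (λ { (Fin.suc x) → C⊆B x }) , #C
shrink {suc n} B (suc k) (s≤s k≤) | true with shrink (B ∘ Fin.suc) k k≤
... | C , C⊆B , #C =
  (λ { Fin.zero → true ; (Fin.suc x) → C x }) , (λ { Fin.zero _ → eq ; (Fin.suc x) → C⊆B x }) , cong suc #C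
shrink {suc n} B k k≤ | false with shrink (B ∘ Fin.suc) k k≤
... | C , C⊆B , #C = (λ { Fin.zero → false ; (Fin.suc x) → C x }) , (λ { (Fin.suc x) → C⊆B x }) , #C

#-full : ∀ k → # {k} (λ _ → true) ≡ k
#-full zero    = refl
#-full (suc k) = cong suc (#-full k)

#-empty : ∀ k → # {k} (λ _ → false) ≡ 0
#-empty zero    = refl
#-empty (suc k) = #-empty k

#-subset : (S : Subset n) → # (lookup S) ≡ ∣ S ∣
#-subset []          = refl
#-subset (true  ∷ S) = cong suc (#-subset S)
#-subset (false ∷ S) = #-subset S

-- Relations without closed walks of length at most 4

Rel₂ : ℕ → Set
Rel₂ n = Fin n → PSet n

-- Closed walks, unlike cycles, carry no distinctness conditions, so the counting argument never has
-- to compare the vertices along a walk.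
record NoShortWalk (E : Rel₂ n) : Set where
  field
    no₁ : ∀ {u} → E u u ≡ true → ⊥
    no₂ : ∀ {u v} → E u v ≡ true → E v u ≡ true → ⊥
    no₃ : ∀ {u v w} → E u v ≡ true → E v w ≡ true → E w u ≡ true → ⊥
    no₄ : ∀ {u v w x} → E u v ≡ true → E v w ≡ true → E w x ≡ true → E x u ≡ true → ⊥

NoShortWalk-⊆ : {E F : Rel₂ n} → (∀ u → F u ⊆ E u) → NoShortWalk E → NoShortWalk F
NoShortWalk-⊆ F⊆E h = record
  { no₁ = λ a → no₁ (F⊆E _ _ a)
  ; no₂ = λ a b → no₂ (F⊆E _ _ a) (F⊆E _ _ b)
  ; no₃ = λ a b c → no₃ (F⊆E _ _ a) (F⊆E _ _ b) (F⊆E _ _ c)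
  ; no₄ = λ a b c d → no₄ (F⊆E _ _ a) (F⊆E _ _ b) (F⊆E _ _ c) (F⊆E _ _ d)
  }
  where open NoShortWalk h

-- With the larger number written as the smaller one plus `d`, the two sides differ by `d * d`.
2ab≤a²+b² : ∀ a b → 2 * (a * b) ≤ a * a + b * b
2ab≤a²+b² a b = case (≤-total a b)
  where
  identity : ∀ x d → 2 * (x * (x + d)) + d * d ≡ x * x + (x + d) * (x + d)
  identity = solve-∀
  ordered : ∀ {a b} → a ≤ b → 2 * (a * b) ≤ a * a + b * b
  ordered {a} a≤b with m≤n⇒∃[o]m+o≡n a≤b
  ... | d , refl = m+n≤o⇒m≤o _ (≤-reflexive (identity a d))
  case : a ≤ b ⊎ b ≤ a → 2 * (a * b) ≤ a * a + b * b
  case (inj₁ a≤b) = ordered a≤b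
  case (inj₂ b≤a) = subst₂ _≤_ (cong (2 *_) (*-comm b a)) (+-comm (b * b) (a * a)) (ordered b≤a)

-- Weighted counts of arcs and transitive triangles in an r-outregular relation on H

module Regular {n} (H : PSet n) (F : Rel₂ n) (r : ℕ)
  (F-source : ∀ {u v} → F u v ≡ true → u ∈ H)
  (F-target : ∀ {u v} → F u v ≡ true → v ∈ H)
  (outdeg : ∀ u → u ∈ H → # (F u) ≡ r)
  (short : NoShortWalk F) where

  open NoShortWalk short

  ∑arcs : (Fin n → Fin n → ℕ) → ℕ
  ∑arcs g = ∑[ u < n ] ∑[ v < n ] (𝟙 (F u v) * g u v)

  indeg : Fin n → ℕ
  indeg v = # (λ z → F z v)

  commonOut commonIn : Fin n → Fin n → ℕ
  commonOut u v = # (F u ∩ F v)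
  commonIn  u v = # ((λ z → F z u) ∩ (λ z → F z v))

  arcs triangles : ℕ
  arcs = # H * r
  triangles = ∑arcs commonOut

  ∑arcs-mono : ∀ {g h} → (∀ u v → F u v ≡ true → g u v ≤ h u v) → ∑arcs g ≤ ∑arcs h
  ∑arcs-mono g≤h = sum-mono-≤ λ u → sum-mono-≤ λ v → guarded (F u v) (g≤h u v)
    where
    guarded : ∀ b {x y} → (b ≡ true → x ≤ y) → 𝟙 b * x ≤ 𝟙 b * y
    guarded true  h = *-monoʳ-≤ 1 (h refl)
    guarded false h = z≤n

  ∑arcs-+ : ∀ g h → ∑arcs (λ u v → g u v + h u v) ≡ ∑arcs g + ∑arcs h
  ∑arcs-+ g h = begin
    ∑arcs (λ u v → g u v + h u v)
      ≡⟨ sum-cong-≗ (λ u → trans (sum-cong-≗ λ v → *-distribˡ-+ (𝟙 (F u v)) (g u v) (h u v))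
                                 (∑-distrib-+ (λ v → 𝟙 (F u v) * g u v) (λ v → 𝟙 (F u v) * h u v))) ⟩
    ∑[ u < n ] (∑[ v < n ] (𝟙 (F u v) * g u v) + ∑[ v < n ] (𝟙 (F u v) * h u v))
      ≡⟨ ∑-distrib-+ (λ u → ∑[ v < n ] (𝟙 (F u v) * g u v)) (λ u → ∑[ v < n ] (𝟙 (F u v) * h u v)) ⟩
    ∑arcs g + ∑arcs h ∎
    where open ≡-Reasoning

  ∑arcs-* : ∀ k g → ∑arcs (λ u v → k * g u v) ≡ k * ∑arcs g
  ∑arcs-* k g = begin
    ∑arcs (λ u v → k * g u v)
      ≡⟨ sum-cong-≗ (λ u → trans (sum-cong-≗ λ v → swap (𝟙 (F u v)) k (g u v))
                                 (sym (*-distribˡ-sum k (λ v → 𝟙 (F u v) * g u v)))) ⟩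
    ∑[ u < n ] (k * ∑[ v < n ] (𝟙 (F u v) * g u v))
      ≡⟨ *-distribˡ-sum k (λ u → ∑[ v < n ] (𝟙 (F u v) * g u v)) ⟨
    k * ∑arcs g ∎
    where
    open ≡-Reasoning
    swap : ∀ a b c → a * (b * c) ≡ b * (a * c)
    swap = solve-∀

  outdeg-𝟙 : ∀ u → # (F u) ≡ 𝟙 (H u) * r
  outdeg-𝟙 u with H u in eq
  ... | true  = trans (outdeg u eq) (sym (+-identityʳ r))
  ... | false = n≤0⇒n≡0 (≤-trans (#-mono {B = λ _ → false} empty) (≤-reflexive (#-empty n)))
    where
    empty : F u ⊆ (λ _ → false)
    empty v a with trans (sym eq) (F-source a)
    ... | ()

  ∑outdeg : ∑[ u < n ] # (F u) ≡ arcs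
  ∑outdeg = trans (sum-cong-≗ outdeg-𝟙) (sym (*-distribʳ-sum r (𝟙 ∘ H)))

  ∑indeg : ∑[ v < n ] indeg v ≡ arcs
  ∑indeg = trans (∑-comm (λ v u → 𝟙 (F u v))) ∑outdeg

  ∑arcs-const : ∀ k → ∑arcs (λ _ _ → k) ≡ k * arcs
  ∑arcs-const k = begin
    ∑arcs (λ _ _ → k)                ≡⟨ sum-cong-≗ (λ u → sym (*-distribʳ-sum k (𝟙 ∘ F u))) ⟩
    ∑[ u < n ] (# (F u) * k)         ≡⟨ *-distribʳ-sum k (λ u → # (F u)) ⟨
    (∑[ u < n ] # (F u)) * k         ≡⟨ cong (_* k) ∑outdeg ⟩
    arcs * k                         ≡⟨ *-comm arcs k ⟩
    k * arcs                         ∎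
    where open ≡-Reasoning

  indeg-outside : ∀ v → H v ≡ false → indeg v ≡ 0
  indeg-outside v v∉H = trans (sum-cong-≗ λ z → none (F z v) refl) (#-empty n)
    where
    none : ∀ {z} b → F z v ≡ b → 𝟙 b ≡ 0
    none false _ = refl
    none true  a with trans (sym v∉H) (F-target a)
    ... | ()

  -- Each `u` in `H` is the source of `r` arcs, so its indegree is counted `r` times. Outside `H`
  -- the indegree is 0 and both terms vanish.
  ∑arcs-indeg-source : ∑arcs (λ u _ → indeg u) ≡ r * arcs
  ∑arcs-indeg-source = begin
    ∑arcs (λ u _ → indeg u)          ≡⟨ sum-cong-≗ (λ u → sym (*-distribʳ-sum (indeg u) (𝟙 ∘ F u))) ⟩
    ∑[ u < n ] (# (F u) * indeg u)   ≡⟨ sum-cong-≗ pointwise ⟩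
    ∑[ u < n ] (r * indeg u)         ≡⟨ *-distribˡ-sum r indeg ⟨
    r * (∑[ u < n ] indeg u)         ≡⟨ cong (r *_) ∑indeg ⟩
    r * arcs                         ∎
    where
    open ≡-Reasoning
    pointwise : ∀ u → # (F u) * indeg u ≡ r * indeg u
    pointwise u with H u in eq
    ... | true  = cong (_* indeg u) (outdeg u eq)
    ... | false = begin
      # (F u) * indeg u  ≡⟨ cong (# (F u) *_) (indeg-outside u eq) ⟩
      # (F u) * 0        ≡⟨ *-zeroʳ (# (F u)) ⟩
      0                  ≡⟨ *-zeroʳ r ⟨
      r * 0              ≡⟨ cong (r *_) (indeg-outside u eq) ⟨
      r * indeg u        ∎

  -- The sum is that of the squared indegrees, whose average is r.
  ∑arcs-indeg-target : r * arcs ≤ ∑arcs (λ _ v → indeg v)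
  ∑arcs-indeg-target = +-cancelʳ-≤ (r * arcs) (r * arcs) _ (begin
    r * arcs + r * arcs
      ≡⟨ cong (λ x → r * arcs + x) (+-identityʳ (r * arcs)) ⟨
    2 * (r * arcs)
      ≡⟨ cong (λ a → 2 * (r * a)) ∑indeg ⟨
    2 * (r * (∑[ v < n ] indeg v))
      ≡⟨ trans (cong (2 *_) (*-distribˡ-sum r indeg)) (*-distribˡ-sum 2 (λ v → r * indeg v)) ⟩
    ∑[ v < n ] (2 * (r * indeg v))
      -- Over `H` this is the nonnegativity of the square of `indeg v` minus `r`. The `r * arcs`
      -- added to both sides is r² summed over `H`; it avoids subtraction.
      ≤⟨ sum-mono-≤ pointwise ⟩
    ∑[ v < n ] (indeg v * indeg v + 𝟙 (H v) * (r * r))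
      ≡⟨ ∑-distrib-+ (λ v → indeg v * indeg v) (λ v → 𝟙 (H v) * (r * r)) ⟩
    ∑[ v < n ] (indeg v * indeg v) + ∑[ v < n ] (𝟙 (H v) * (r * r))
      ≡⟨ cong₂ _+_ squares (trans (sym (*-distribʳ-sum (r * r) (𝟙 ∘ H))) (rotate (# H) r)) ⟩
    ∑arcs (λ _ v → indeg v) + r * arcs ∎)
    where
    open ≤-Reasoning
    rotate : ∀ m r → m * (r * r) ≡ r * (m * r)
    rotate = solve-∀
    squares : ∑[ v < n ] (indeg v * indeg v) ≡ ∑arcs (λ _ v → indeg v)
    squares = trans (sum-cong-≗ λ v → *-distribʳ-sum (indeg v) (λ u → 𝟙 (F u v)))
                    (∑-comm (λ v u → 𝟙 (F u v) * indeg v))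
    pointwise : ∀ v → 2 * (r * indeg v) ≤ indeg v * indeg v + 𝟙 (H v) * (r * r)
    pointwise v with H v in eq
    ... | true  = begin
      2 * (r * indeg v)                 ≤⟨ 2ab≤a²+b² r (indeg v) ⟩
      r * r + indeg v * indeg v         ≡⟨ +-comm (r * r) _ ⟩
      indeg v * indeg v + r * r         ≡⟨ cong (λ x → indeg v * indeg v + x) (+-identityʳ (r * r)) ⟨
      indeg v * indeg v + (r * r + 0)   ∎
    ... | false = begin
      2 * (r * indeg v)   ≡⟨ cong (λ d → 2 * (r * d)) (indeg-outside v eq) ⟩
      2 * (r * 0)         ≡⟨ cong (2 *_) (*-zeroʳ r) ⟩
      0                   ≤⟨ z≤n ⟩
      _                   ∎

  triangles-sum : triangles ≡ ∑[ u < n ] ∑[ v < n ] ∑[ w < n ] (𝟙 (F u v) * (𝟙 (F u w) * 𝟙 (F v w)))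
  triangles-sum = sum-cong-≗ λ u → sum-cong-≗ λ v →
    trans (cong (𝟙 (F u v) *_) (sum-cong-≗ λ w → 𝟙-∧ (F u w) (F v w)))
          (*-distribˡ-sum (𝟙 (F u v)) (λ w → 𝟙 (F u w) * 𝟙 (F v w)))

  -- The triangle z → u, z → v, u → v is counted on the left at the arc u → v with common
  -- inneighbour z, and on the right at the arc z → u with common outneighbour v.
  ∑arcs-commonIn : ∑arcs commonIn ≡ triangles
  ∑arcs-commonIn = begin
    ∑arcs commonIn
      ≡⟨ sum-cong-≗ (λ u → sum-cong-≗ λ v →
           trans (cong (𝟙 (F u v) *_) (sum-cong-≗ λ z → 𝟙-∧ (F z u) (F z v)))
                 (*-distribˡ-sum (𝟙 (F u v)) (λ z → 𝟙 (F z u) * 𝟙 (F z v)))) ⟩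
    ∑[ u < n ] ∑[ v < n ] ∑[ z < n ] (𝟙 (F u v) * (𝟙 (F z u) * 𝟙 (F z v)))
      ≡⟨ sum-cong-≗ (λ u → ∑-comm (λ v z → 𝟙 (F u v) * (𝟙 (F z u) * 𝟙 (F z v)))) ⟩
    ∑[ u < n ] ∑[ z < n ] ∑[ v < n ] (𝟙 (F u v) * (𝟙 (F z u) * 𝟙 (F z v)))
      ≡⟨ ∑-comm (λ u z → ∑[ v < n ] (𝟙 (F u v) * (𝟙 (F z u) * 𝟙 (F z v)))) ⟩
    ∑[ z < n ] ∑[ u < n ] ∑[ v < n ] (𝟙 (F u v) * (𝟙 (F z u) * 𝟙 (F z v)))
      ≡⟨ sum-cong-≗ (λ z → sum-cong-≗ λ u → sum-cong-≗ λ v → rotate (𝟙 (F u v)) (𝟙 (F z u)) (𝟙 (F z v))) ⟩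
    ∑[ z < n ] ∑[ u < n ] ∑[ v < n ] (𝟙 (F z u) * (𝟙 (F z v) * 𝟙 (F u v)))
      ≡⟨ triangles-sum ⟨
    triangles ∎
    where
    open ≡-Reasoning
    rotate : ∀ a b c → a * (b * c) ≡ b * (c * a)
    rotate = solve-∀

  -- Without 2-cycles, the out-neighbourhood of each vertex spans at most r(r - 1)/2 arcs.
  2*triangles≤ : 2 * triangles ≤ r * arcs
  2*triangles≤ = begin
    2 * triangles
      ≡⟨ cong (2 *_) triangles-sum ⟩
    2 * (∑[ u < n ] local u)
      ≡⟨ *-distribˡ-sum 2 local ⟩
    ∑[ u < n ] (2 * local u)
      ≤⟨ sum-mono-≤ local≤ ⟩
    ∑[ u < n ] (# (F u) * # (F u))
      ≡⟨ sum-cong-≗ square ⟩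
    ∑[ u < n ] (r * # (F u))
      ≡⟨ *-distribˡ-sum r (λ u → # (F u)) ⟨
    r * (∑[ u < n ] # (F u))
      ≡⟨ cong (r *_) ∑outdeg ⟩
    r * arcs ∎
    where
    open ≤-Reasoning
    term : Fin n → Fin n → Fin n → ℕ
    term u v w = 𝟙 (F u v) * (𝟙 (F u w) * 𝟙 (F v w))

    local : Fin n → ℕ
    local u = ∑[ v < n ] ∑[ w < n ] term u v w

    antisymmetric : ∀ u v w → term u v w + term u w v ≤ 𝟙 (F u v) * 𝟙 (F u w)
    antisymmetric u v w = begin
      term u v w + term u w v
        ≡⟨ factor (𝟙 (F u v)) (𝟙 (F u w)) (𝟙 (F v w)) (𝟙 (F w v)) ⟩
      𝟙 (F u v) * 𝟙 (F u w) * (𝟙 (F v w) + 𝟙 (F w v))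
        ≤⟨ *-monoʳ-≤ (𝟙 (F u v) * 𝟙 (F u w)) (atMostOne (F v w) (F w v) no₂) ⟩
      𝟙 (F u v) * 𝟙 (F u w) * 1
        ≡⟨ *-identityʳ _ ⟩
      𝟙 (F u v) * 𝟙 (F u w) ∎
      where
      factor : ∀ a b c d → a * (b * c) + b * (a * d) ≡ a * b * (c + d)
      factor = solve-∀
      atMostOne : ∀ a b → (a ≡ true → b ≡ true → ⊥) → 𝟙 a + 𝟙 b ≤ 1
      atMostOne true  true  h = ⊥-elim (h refl refl)
      atMostOne true  false h = ≤-refl
      atMostOne false true  h = ≤-refl
      atMostOne false false h = z≤n

    local≤ : ∀ u → 2 * local u ≤ # (F u) * # (F u)
    local≤ u = begin
      2 * local u
        -- One of the two copies of `local u` is transposed, so that the terms for v → w and w → v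
        -- meet and at most one of them survives. The diagonal pairs are not split off, which gives
        -- the square of the outdegree as the bound.
        ≡⟨ cong (λ x → local u + x) (trans (+-identityʳ (local u)) (∑-comm (term u))) ⟩
      local u + ∑[ v < n ] ∑[ w < n ] term u w v
        ≡⟨ trans (sum-cong-≗ λ v → ∑-distrib-+ (term u v) (λ w → term u w v))
                 (∑-distrib-+ (λ v → ∑[ w < n ] term u v w) (λ v → ∑[ w < n ] term u w v)) ⟨
      ∑[ v < n ] ∑[ w < n ] (term u v w + term u w v)
        ≤⟨ (sum-mono-≤ λ v → sum-mono-≤ λ w → antisymmetric u v w) ⟩
      ∑[ v < n ] ∑[ w < n ] (𝟙 (F u v) * 𝟙 (F u w))
        ≡⟨ trans (*-distribʳ-sum (# (F u)) (𝟙 ∘ F u))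
                 (sum-cong-≗ λ v → *-distribˡ-sum (𝟙 (F u v)) (𝟙 ∘ F u)) ⟨
      # (F u) * # (F u) ∎

    square : ∀ u → # (F u) * # (F u) ≡ r * # (F u)
    square u rewrite outdeg-𝟙 u with H u
    ... | true  = cong (_* (r + 0)) (+-identityʳ r)
    ... | false = sym (*-zeroʳ r)

  -- Density bound for a regular relation whose proper subsets have sparse vertices

  module Dense (p s : ℕ) (p>0 : 0 < p) (r>0 : 0 < r) (pm≤qr : p * # H ≤ (p + s) * r)
    (sparse : ∀ A → A ⊆ H → (∃[ y ] (y ∈ H × (y ∈ A → ⊥))) → 0 < # A →
              ∃[ x ] (x ∈ A × (p + s) * # (A ∩ F x) ≤ p * # A)) where

    -- The density a is p / q and 1 - a is s / q. Starting from `p` and `s` keeps 1 - a free of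
    -- truncated subtraction.
    q : ℕ
    q = p + s

    module Arc (u v : Fin n) (uv : F u v ≡ true) where

      -- In both cases there is a walk of length 2 from u to y, through v or w, and a walk of length
      -- at most 2 from v to y. One further step and an arc back to u or v then make a closed walk
      -- of length at most 4.
      Reach : Fin n → Set
      Reach y = F v y ≡ true ⊎ (∃[ w ] (F u w ≡ true × F v w ≡ true × F w y ≡ true))

      t : ℕ
      t = commonOut u v

      Reach-⊆H : ∀ y → Reach y → y ∈ H
      Reach-⊆H y (inj₁ vy)               = F-target vy
      Reach-⊆H y (inj₂ (w , _ , _ , wy)) = F-target wy

      u-unreached : Reach u → ⊥
      u-unreached (inj₁ vu)                = no₂ uv vu
      u-unreached (inj₂ (w , uw , _ , wu)) = no₂ uw wu

      -- If T is the set of the `t` common outneighbours and w is sparse in T, then few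
      -- outneighbours of v that lie in T are outneighbours of w, so joining `F w` to `F v` gains at
      -- least (1 - a)t vertices. The bound `r ≤ # A` later shows that A is nonempty.
      firstStep : ∃[ A ] ((∀ y → y ∈ A → Reach y) × r ≤ # A × q * r + s * t ≤ q * # A)
      firstStep with t in t≡
      -- `sparse` needs a nonempty set, so an empty T is treated apart; here the size bound is an
      -- equality.
      ... | zero = F v , (λ y → inj₁) , ≤-reflexive (sym #Fv) , (begin
        q * r + s * 0   ≡⟨ cong (λ x → q * r + x) (*-zeroʳ s) ⟩
        q * r + 0       ≡⟨ +-identityʳ (q * r) ⟩
        q * r           ≡⟨ cong (q *_) #Fv ⟨
        q * # (F v)     ∎)
        where
        open ≤-Reasoning
        #Fv : # (F v) ≡ r
        #Fv = outdeg v (F-target uv)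
      ... | suc t′ with sparse (F u ∩ F v) (λ y → F-target ∘ proj₁ ∘ ∈-∩⁻ (F u) (F v) y)
                          (u , F-source uv , no₁ ∘ proj₁ ∘ ∈-∩⁻ (F u) (F v) u)
                          (subst (0 <_) (sym t≡) (s≤s z≤n))
      ... | w , w∈T , w-sparse = A , reach , ≤-trans (≤-reflexive (sym #Fv)) (#-mono (p⊆p∪q (F v) (F w))) , size
        where
        uw : F u w ≡ true
        uw = proj₁ (∈-∩⁻ (F u) (F v) w w∈T)
        vw : F v w ≡ true
        vw = proj₂ (∈-∩⁻ (F u) (F v) w w∈T)
        #Fv : # (F v) ≡ r
        #Fv = outdeg v (F-target uv)
        #Fw : # (F w) ≡ r
        #Fw = outdeg w (F-target uw)
        A : PSet n
        A = F v ∪ F w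
        reach : ∀ y → y ∈ A → Reach y
        reach y y∈A with ∈-∪⁻ (F v) (F w) y y∈A
        ... | inj₁ vy = inj₁ vy
        ... | inj₂ wy = inj₂ (w , uw , vw , wy)
        -- T and `F v ∩ F w` both lie in `F v`, which has `r` elements, and they meet inside T ∩
        -- `F w`.
        common≤ : # (F v ∩ F w) + suc t′ ≤ # ((F u ∩ F v) ∩ F w) + r
        common≤ = begin
          # (F v ∩ F w) + suc t′
            ≡⟨ cong (λ x → # (F v ∩ F w) + x) t≡ ⟨
          # (F v ∩ F w) + # (F u ∩ F v)
            ≡⟨ #-∪-∩ (F v ∩ F w) (F u ∩ F v) ⟨
          # ((F v ∩ F w) ∪ (F u ∩ F v)) + # ((F v ∩ F w) ∩ (F u ∩ F v))
            ≤⟨ +-mono-≤ (#-mono inFv) (#-mono inT) ⟩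
          # (F v) + # ((F u ∩ F v) ∩ F w)
            ≡⟨ trans (+-comm (# (F v)) _) (cong (λ x → # ((F u ∩ F v) ∩ F w) + x) #Fv) ⟩
          # ((F u ∩ F v) ∩ F w) + r ∎
          where
          open ≤-Reasoning
          inFv : (F v ∩ F w) ∪ (F u ∩ F v) ⊆ F v
          inFv y y∈ with ∈-∪⁻ (F v ∩ F w) (F u ∩ F v) y y∈
          ... | inj₁ h = proj₁ (∈-∩⁻ (F v) (F w) y h)
          ... | inj₂ h = proj₂ (∈-∩⁻ (F u) (F v) y h)
          inT : (F v ∩ F w) ∩ (F u ∩ F v) ⊆ (F u ∩ F v) ∩ F w
          inT y y∈ with ∈-∩⁻ (F v ∩ F w) (F u ∩ F v) y y∈
          ... | a , b = ∈-∩⁺ (F u ∩ F v) (F w) y b (proj₂ (∈-∩⁻ (F v) (F w) y a))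
        size : q * r + s * suc t′ ≤ q * # A
        size = +-cancelʳ-≤ (q * (# (F v ∩ F w) + suc t′)) _ _ (begin
          q * r + s * suc t′ + q * (# (F v ∩ F w) + suc t′)
            ≤⟨ +-monoʳ-≤ (q * r + s * suc t′) (*-monoʳ-≤ q common≤) ⟩
          q * r + s * suc t′ + q * (# ((F u ∩ F v) ∩ F w) + r)
            ≡⟨ collect q s r (suc t′) (# ((F u ∩ F v) ∩ F w)) ⟩
          q * # ((F u ∩ F v) ∩ F w) + (q * (r + r) + s * suc t′)
            ≤⟨ +-monoˡ-≤ _ w-sparse ⟩
          p * t + (q * (r + r) + s * suc t′)
            ≡⟨ cong (λ x → p * x + (q * (r + r) + s * suc t′)) t≡ ⟩
          p * suc t′ + (q * (r + r) + s * suc t′)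
            ≡⟨ merge p s r (suc t′) ⟩
          q * (r + r) + q * suc t′
            ≡⟨ cong (λ x → q * x + q * suc t′) (trans (#-∪-∩ (F v) (F w)) (cong₂ _+_ #Fv #Fw)) ⟨
          q * (# A + # (F v ∩ F w)) + q * suc t′
            ≡⟨ split q (# A) (# (F v ∩ F w)) (suc t′) ⟩
          q * # A + q * (# (F v ∩ F w) + suc t′) ∎)
          where
          open ≤-Reasoning
          collect : ∀ q s r t x → q * r + s * t + q * (x + r) ≡ q * x + (q * (r + r) + s * t)
          collect = solve-∀
          merge : ∀ p s r t → p * t + ((p + s) * (r + r) + s * t) ≡ (p + s) * (r + r) + (p + s) * t
          merge = solve-∀
          split : ∀ q a b c → q * (a + b) + q * c ≡ q * a + q * (b + c)
          split = solve-∀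

      -- This is |S| + |B| ≤ |H| multiplied by q². The first three terms come from |S| ≥ (1 - a)|A|
      -- + r and |A| ≥ r + (1 - a)t; the size of B, the set of inneighbours of u or v, is the sum of
      -- the two indegrees minus `commonIn u v`.
      arcBound : q * (s * r) + s * s * t + q * q * r + q * q * (indeg u + indeg v) ≤
                 q * q * # H + q * q * commonIn u v
      arcBound with firstStep
      ... | A , reach , r≤#A , A-size with sparse A (λ y y∈ → Reach-⊆H y (reach y y∈))
              -- The vertex u shows that A is a proper subset of `H`: reaching u would close a walk
              -- of length 2.
              (u , F-source uv , u-unreached ∘ reach u) (<-≤-trans r>0 r≤#A)
      ... | x , x∈A , x-sparse = begin
        q * (s * r) + s * s * t + q * q * r + q * q * (indeg u + indeg v)
          ≡⟨ collect₁ q s r t (indeg u + indeg v) ⟩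
        s * (q * r + s * t) + q * (q * r) + q * q * (indeg u + indeg v)
          ≤⟨ +-monoˡ-≤ _ (+-monoˡ-≤ (q * (q * r)) (*-monoʳ-≤ s A-size)) ⟩
        s * (q * # A) + q * (q * r) + q * q * (indeg u + indeg v)
          ≡⟨ cong (λ x → s * (q * # A) + q * (q * r) + q * q * x) (#-∪-∩ (λ z → F z u) (λ z → F z v)) ⟨
        s * (q * # A) + q * (q * r) + q * q * (# B + commonIn u v)
          ≡⟨ collect₂ q s r (# A) (# B) (commonIn u v) ⟩
        q * (s * # A + q * r) + q * q * (# B + commonIn u v)
          ≤⟨ +-monoˡ-≤ _ (*-monoʳ-≤ q S-size) ⟩
        q * (q * # S) + q * q * (# B + commonIn u v)
          ≡⟨ collect₃ q (# S) (# B) (commonIn u v) ⟩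
        q * q * (# S + # B) + q * q * commonIn u v
          ≤⟨ +-monoˡ-≤ _ (*-monoʳ-≤ (q * q) (#-disjoint S⊆H B⊆H disjoint)) ⟩
        q * q * # H + q * q * commonIn u v ∎
        where
        open ≤-Reasoning
        S B : PSet n
        S = A ∪ F x
        B = (λ z → F z u) ∪ (λ z → F z v)
        collect₁ : ∀ q s r t d → q * (s * r) + s * s * t + q * q * r + q * q * d ≡
                                 s * (q * r + s * t) + q * (q * r) + q * q * d
        collect₁ = solve-∀
        collect₂ : ∀ q s r a b c → s * (q * a) + q * (q * r) + q * q * (b + c) ≡
                                   q * (s * a + q * r) + q * q * (b + c)
        collect₂ = solve-∀
        collect₃ : ∀ q a b c → q * (q * a) + q * q * (b + c) ≡ q * q * (a + b) + q * q * c
        collect₃ = solve-∀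
        S-size : s * # A + q * r ≤ q * # S
        S-size = +-cancelʳ-≤ (p * # A) _ _ (begin
          s * # A + q * r + p * # A     ≡⟨ merge p s r (# A) ⟩
          q * (# A + r)                 ≡⟨ cong (λ y → q * (# A + y)) (outdeg x (Reach-⊆H x (reach x x∈A))) ⟨
          q * (# A + # (F x))           ≡⟨ cong (q *_) (#-∪-∩ A (F x)) ⟨
          q * (# S + # (A ∩ F x))       ≡⟨ *-distribˡ-+ q (# S) _ ⟩
          q * # S + q * # (A ∩ F x)     ≤⟨ +-monoʳ-≤ (q * # S) x-sparse ⟩
          q * # S + p * # A             ∎)
          where
          merge : ∀ p s r a → s * a + (p + s) * r + p * a ≡ (p + s) * (a + r)
          merge = solve-∀
        S⊆H : S ⊆ H
        S⊆H y y∈S with ∈-∪⁻ A (F x) y y∈S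
        ... | inj₁ y∈A = Reach-⊆H y (reach y y∈A)
        ... | inj₂ xy  = F-target xy
        B⊆H : B ⊆ H
        B⊆H z z∈B with ∈-∪⁻ (λ z → F z u) (λ z → F z v) z z∈B
        ... | inj₁ zu = F-source zu
        ... | inj₂ zv = F-source zv
        -- A vertex y of A with an arc to u or v closes a walk of length 2 or 3; a vertex y of `F x`
        -- closes one of length 3 or 4.
        disjoint : ∀ y → y ∈ S → y ∈ B → ⊥
        disjoint y y∈S y∈B with ∈-∪⁻ A (F x) y y∈S | ∈-∪⁻ (λ z → F z u) (λ z → F z v) y y∈B
        disjoint y _ _ | inj₁ y∈A | yB with reach y y∈A | yB
        ... | inj₁ vy                 | inj₁ yu = no₃ uv vy yu
        ... | inj₁ vy                 | inj₂ yv = no₂ vy yv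
        ... | inj₂ (w , uw , _ , wy)  | inj₁ yu = no₃ uw wy yu
        ... | inj₂ (w , _ , vw , wy)  | inj₂ yv = no₃ vw wy yv
        disjoint y _ _ | inj₂ xy | yB with reach x x∈A | yB
        ... | inj₁ vx                 | inj₁ yu = no₄ uv vx xy yu
        ... | inj₁ vx                 | inj₂ yv = no₃ vx xy yv
        ... | inj₂ (w , uw , _ , wx)  | inj₁ yu = no₄ uw wx xy yu
        ... | inj₂ (w , _ , vw , wx)  | inj₂ yv = no₄ vw wx xy yv

    -- `arcBound` is summed over all arcs. Both kinds of common neighbours add up to `triangles`,
    -- while the indegrees of sources contribute exactly `r * arcs` and those of targets at least as
    -- much.
    summedBound : (q * (s * r) + q * q * r) * arcs + s * s * triangles + q * q * (r * arcs + r * arcs) ≤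
                  q * q * # H * arcs + q * q * triangles
    summedBound = begin
      (q * (s * r) + q * q * r) * arcs + s * s * triangles + q * q * (r * arcs + r * arcs)
        ≤⟨ +-monoʳ-≤ ((q * (s * r) + q * q * r) * arcs + s * s * triangles)
             (*-monoʳ-≤ (q * q) (+-mono-≤ (≤-reflexive (sym ∑arcs-indeg-source)) ∑arcs-indeg-target)) ⟩
      (q * (s * r) + q * q * r) * arcs + s * s * triangles
        + q * q * (∑arcs (λ u _ → indeg u) + ∑arcs (λ _ v → indeg v))
        ≡⟨ cong₂ _+_ (cong₂ _+_ (sym (∑arcs-const _)) (sym (∑arcs-* (s * s) commonOut)))
             (trans (cong (q * q *_) (sym (∑arcs-+ (λ u _ → indeg u) (λ _ v → indeg v))))
                    (sym (∑arcs-* (q * q) (λ u v → indeg u + indeg v)))) ⟩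
      ∑arcs (λ _ _ → q * (s * r) + q * q * r) + ∑arcs (λ u v → s * s * commonOut u v)
        + ∑arcs (λ u v → q * q * (indeg u + indeg v))
        ≡⟨ trans (∑arcs-+ _ (λ u v → q * q * (indeg u + indeg v)))
                 (cong (_+ ∑arcs (λ u v → q * q * (indeg u + indeg v))) (∑arcs-+ _ (λ u v → s * s * commonOut u v))) ⟨
      ∑arcs (λ u v → q * (s * r) + q * q * r + s * s * commonOut u v + q * q * (indeg u + indeg v))
        ≤⟨ ∑arcs-mono (λ u v uv → ≤-trans (≤-reflexive
             (reorder (q * (s * r)) (q * q * r) (s * s * commonOut u v) (q * q * (indeg u + indeg v))))
             (Arc.arcBound u v uv)) ⟩
      ∑arcs (λ u v → q * q * # H + q * q * commonIn u v)
        ≡⟨ trans (∑arcs-+ (λ _ _ → q * q * # H) (λ u v → q * q * commonIn u v))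
             (cong₂ _+_ (∑arcs-const (q * q * # H))
               (trans (∑arcs-* (q * q) commonIn) (cong (q * q *_) ∑arcs-commonIn))) ⟩
      q * q * # H * arcs + q * q * triangles ∎
      where
      open ≤-Reasoning
      reorder : ∀ a b c d → a + b + c + d ≡ a + c + b + d
      reorder = solve-∀

    -- a(4 - 2a + a²/2) ≤ 1, cleared of denominators; p (p + 2 s) stands for q² - s².
    densityBound : 0 < # H →
      2 * p * (s * q + 3 * (q * q)) ≤ 2 * (q * q * q) + p * (p * (p + 2 * s))
    densityBound m>0 = *-cancelʳ-≤ _ _ r {{>-nonZero r>0}} (begin
      2 * p * (s * q + 3 * (q * q)) * r
        ≡⟨ shuffle₁ p s q r ⟩
      p * (2 * ((s * q + 3 * (q * q)) * r))
        ≤⟨ *-monoʳ-≤ p perArc ⟩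
      p * (2 * (q * q * # H) + k * r)
        ≡⟨ shuffle₂ p q k r (# H) ⟩
      2 * (q * q * (p * # H)) + p * k * r
        -- The density hypothesis trades `p * # H` for `q * r`, after which every term is a multiple
        -- of `r`.
        ≤⟨ +-monoˡ-≤ (p * k * r) (*-monoʳ-≤ 2 (*-monoʳ-≤ (q * q) pm≤qr)) ⟩
      2 * (q * q * (q * r)) + p * k * r
        ≡⟨ shuffle₃ p q k r ⟩
      (2 * (q * q * q) + p * k) * r ∎)
      where
      open ≤-Reasoning
      k : ℕ
      k = p * (p + 2 * s)
      shuffle₁ : ∀ p s q r → 2 * p * (s * q + 3 * (q * q)) * r ≡ p * (2 * ((s * q + 3 * (q * q)) * r))
      shuffle₁ = solve-∀
      shuffle₂ : ∀ p q k r m → p * (2 * (q * q * m) + k * r) ≡ 2 * (q * q * (p * m)) + p * k * r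
      shuffle₂ = solve-∀
      shuffle₃ : ∀ p q k r → 2 * (q * q * (q * r)) + p * k * r ≡ (2 * (q * q * q) + p * k) * r
      shuffle₃ = solve-∀
      -- Triangles occur with weight s² on the left and q² on the right; cancelling s² leaves the
      -- weight `k`.
      noSquares : (s * q + 3 * (q * q)) * r * arcs ≤ q * q * # H * arcs + k * triangles
      noSquares = +-cancelʳ-≤ (s * s * triangles) _ _ (begin
        (s * q + 3 * (q * q)) * r * arcs + s * s * triangles
          ≡⟨ expand s q r arcs (s * s * triangles) ⟩
        (q * (s * r) + q * q * r) * arcs + s * s * triangles + q * q * (r * arcs + r * arcs)
          ≤⟨ summedBound ⟩
        q * q * # H * arcs + q * q * triangles
          ≡⟨ difference p s (q * q * # H * arcs) triangles ⟩
        q * q * # H * arcs + k * triangles + s * s * triangles ∎)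
        where
        expand : ∀ s q r e x → (s * q + 3 * (q * q)) * r * e + x ≡
                               (q * (s * r) + q * q * r) * e + x + q * q * (r * e + r * e)
        expand = solve-∀
        difference : ∀ p s y x → y + (p + s) * (p + s) * x ≡ y + p * (p + 2 * s) * x + s * s * x
        difference = solve-∀
      perArc : 2 * ((s * q + 3 * (q * q)) * r) ≤ 2 * (q * q * # H) + k * r
      perArc = *-cancelʳ-≤ _ _ arcs {{>-nonZero (*-mono-< m>0 r>0)}} (begin
        2 * ((s * q + 3 * (q * q)) * r) * arcs
          ≡⟨ *-assoc 2 ((s * q + 3 * (q * q)) * r) arcs ⟩
        2 * ((s * q + 3 * (q * q)) * r * arcs)
          ≤⟨ *-monoʳ-≤ 2 noSquares ⟩
        2 * (q * q * # H * arcs + k * triangles)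
          ≡⟨ double (q * q * # H) arcs k triangles ⟩
        2 * (q * q * # H) * arcs + k * (2 * triangles)
          ≤⟨ +-monoʳ-≤ (2 * (q * q * # H) * arcs) (*-monoʳ-≤ k 2*triangles≤) ⟩
        2 * (q * q * # H) * arcs + k * (r * arcs)
          ≡⟨ cong (λ x → 2 * (q * q * # H) * arcs + x) (*-assoc k r arcs) ⟨
        2 * (q * q * # H) * arcs + k * r * arcs
          ≡⟨ *-distribʳ-+ arcs (2 * (q * q * # H)) (k * r) ⟨
        (2 * (q * q * # H) + k * r) * arcs ∎)
        where
        double : ∀ x e k t → 2 * (x * e + k * t) ≡ 2 * x * e + k * (2 * t)
        double = solve-∀

-- Sparse vertices

-- The ceiling of a / q, computed as the floor of (a + q - 1) / q. Its minimality puts it below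
-- every outdegree that meets the density bound.
ceiling : ∀ a q .{{_ : NonZero q}} → ∃[ r ] (a ≤ q * r × (∀ d → a ≤ q * d → r ≤ d))
ceiling a q@(suc q′) = (a + q′) ℕ./ q , below , least
  where
  open ≤-Reasoning
  below : a ≤ q * ((a + q′) ℕ./ q)
  below = +-cancelʳ-≤ q′ a _ (begin
    a + q′                                               ≡⟨ m≡m%n+[m/n]*n (a + q′) q ⟩
    (a + q′) % q + (a + q′) ℕ./ q * q             ≤⟨ +-monoˡ-≤ _ (s≤s⁻¹ (m%n<n (a + q′) q)) ⟩
    q′ + (a + q′) ℕ./ q * q                       ≡⟨ +-comm q′ _ ⟩
    (a + q′) ℕ./ q * q + q′                       ≡⟨ cong (_+ q′) (*-comm _ q) ⟩
    q * ((a + q′) ℕ./ q) + q′                     ∎)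
  least : ∀ d → a ≤ q * d → (a + q′) ℕ./ q ≤ d
  least d a≤qd = s≤s⁻¹ (m<n*o⇒m/o<n {n = suc d} (begin-strict
    a + q′        <⟨ +-mono-≤-< a≤qd (n<1+n q′) ⟩
    q * d + q     ≡⟨ +-comm (q * d) q ⟩
    q + q * d     ≡⟨ cong (λ x → q + x) (*-comm q d) ⟩
    suc d * q     ∎))

module _ {n} (E : Rel₂ n) (short : NoShortWalk E) (p s : ℕ) (p>0 : 0 < p)
  (dense : 2 * ((p + s) * (p + s) * (p + s)) + p * (p * (p + 2 * s)) <
           2 * p * (s * (p + s) + 3 * ((p + s) * (p + s)))) where

  Sparse : PSet n → Set
  Sparse H = ∃[ x ] (x ∈ H × (p + s) * # (H ∩ E x) < p * # H)

  -- With r the ceiling of p|H| / q, every vertex of `H` has at least r outneighbours in `H`.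
  -- Trimming them to exactly r gives a regular relation, for which `densityBound` contradicts
  -- `dense`.
  noDense : ∀ H → 0 < # H → (∀ A → # A < # H → 0 < # A → Sparse A) →
            (∀ x → x ∈ H → p * # H ≤ (p + s) * # (H ∩ E x)) → ⊥
  noDense H H>0 smaller allDense with ceiling (p * # H) (p + s) {{>-nonZero (≤-trans p>0 (m≤m+n p s))}}
  ... | r , pm≤qr , least = <⇒≱ dense (densityBound H>0)
    where
    trimmed : ∀ u → ∃[ C ] (C ⊆ H ∩ E u × (u ∈ H → # C ≡ r) × (∀ v → v ∈ C → u ∈ H))
    trimmed u with H u in u∈H
    -- Vertices outside `H` lose all their arcs, so that every arc of `F` starts in `H`.
    ... | false = (λ _ → false) , (λ _ ()) , (λ ()) , (λ _ ())
    ... | true with shrink (H ∩ E u) r (least _ (allDense u u∈H))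
    ... | C , C⊆ , #C = C , C⊆ , (λ _ → #C) , (λ _ _ → refl)
    F : Rel₂ n
    F = proj₁ ∘ trimmed
    F⊆ : ∀ u → F u ⊆ H ∩ E u
    F⊆ = proj₁ ∘ proj₂ ∘ trimmed
    F⊆E : ∀ u → F u ⊆ E u
    F⊆E u v = proj₂ ∘ ∈-∩⁻ H (E u) v ∘ F⊆ u v
    r>0 : 0 < r
    r>0 = n≢0⇒n>0 λ { refl → <⇒≱ (*-mono-< p>0 H>0) (≤-trans pm≤qr (≤-reflexive (*-zeroʳ (p + s)))) }
    sparse : ∀ A → A ⊆ H → (∃[ y ] (y ∈ H × (y ∈ A → ⊥))) → 0 < # A →
             ∃[ x ] (x ∈ A × (p + s) * # (A ∩ F x) ≤ p * # A)
    sparse A A⊆H (y , y∈H , y∉A) A>0 with smaller A (#-strict-mono A⊆H y y∈H y∉A) A>0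
    ... | x , x∈A , few = x , x∈A , ≤-trans (*-monoʳ-≤ (p + s) (#-mono restrict)) (<⇒≤ few)
      where
      restrict : A ∩ F x ⊆ A ∩ E x
      restrict z z∈ with ∈-∩⁻ A (F x) z z∈
      ... | a , b = ∈-∩⁺ A (E x) z a (F⊆E x z b)
    open Regular H F r
      (λ {u} {v} → proj₂ (proj₂ (proj₂ (trimmed u))) v)
      (λ {u} {v} → proj₁ ∘ ∈-∩⁻ H (E u) v ∘ F⊆ u v)
      (λ u → proj₁ (proj₂ (proj₂ (trimmed u))))
      (NoShortWalk-⊆ F⊆E short)
    open Dense p s p>0 r>0 pm≤qr sparse

  -- The bound `k` turns strong induction on the size of `H` into structural recursion. Sparsity of
  -- a vertex is decidable, so refuting its absence produces one.
  sparseVertex : ∀ k H → # H ≤ k → 0 < # H → Sparse H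
  sparseVertex zero    H H≤0 H>0 = ⊥-elim (<⇒≱ H>0 H≤0)
  sparseVertex (suc k) H H≤k H>0
    with any? (λ x → (H x 𝔹.≟ true) ×-dec ((p + s) * # (H ∩ E x) <? p * # H))
  ... | yes found = found
  ... | no none = ⊥-elim (noDense H H>0
    (λ A A<H → sparseVertex k A (s≤s⁻¹ (≤-trans A<H H≤k)))
    (λ x x∈H → ≮⇒≥ λ few → none (x , x∈H , few)))

-- Short cycles in digraphs

module _ {n} (G : Digraph n) where

  open Digraph G

  adj : Rel₂ n
  adj u v = lookup (out u) v

  arc⁺ : ∀ {u v} → adj u v ≡ true → u ⟶ v
  arc⁺ {u} {v} = lookup⇒[]= v (out u)

  noLoop : ∀ {u} → adj u u ≡ true → ⊥
  noLoop {u} uu = loopless u (arc⁺ uu)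

  adj⇒≢ : ∀ {u v} → adj u v ≡ true → u ≢ v
  adj⇒≢ uv refl = noLoop uv

  2-cycle : ∀ {u v} → adj u v ≡ true → adj v u ≡ true → DirectedCycle G 2
  2-cycle {u} {v} uv vu = record
    { vertex   = lookup (u ∷ v ∷ [])
    ; distinct = lookup-injective ((adj⇒≢ uv ∷ []) ∷ [] ∷ []) _ _
    ; arc      = λ { Fin.zero → arc⁺ uv ; (Fin.suc Fin.zero) → arc⁺ vu }
    }

  3-cycle : ∀ {u v w} → adj u v ≡ true → adj v w ≡ true → adj w u ≡ true → DirectedCycle G 3
  3-cycle {u} {v} {w} uv vw wu = record
    { vertex   = lookup (u ∷ v ∷ w ∷ [])
    ; distinct = lookup-injective ((adj⇒≢ uv ∷ ≢-sym (adj⇒≢ wu) ∷ []) ∷ (adj⇒≢ vw ∷ []) ∷ [] ∷ []) _ _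
    ; arc      = λ { Fin.zero → arc⁺ uv ; (Fin.suc Fin.zero) → arc⁺ vw
                   ; (Fin.suc (Fin.suc Fin.zero)) → arc⁺ wu }
    }

  -- Consecutive vertices differ because there are no loops. If opposite vertices coincided, two
  -- consecutive arcs would form a 2-cycle, hence the extra hypothesis.
  4-cycle : (∀ {u v} → adj u v ≡ true → adj v u ≡ true → ⊥) →
            ∀ {u v w x} → adj u v ≡ true → adj v w ≡ true → adj w x ≡ true → adj x u ≡ true →
            DirectedCycle G 4
  4-cycle no₂ {u} {v} {w} {x} uv vw wx xu = record
    { vertex   = lookup (u ∷ v ∷ w ∷ x ∷ [])
    ; distinct = lookup-injective
        ((adj⇒≢ uv ∷ (λ { refl → no₂ uv vw }) ∷ ≢-sym (adj⇒≢ xu) ∷ []) ∷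
         (adj⇒≢ vw ∷ (λ { refl → no₂ vw wx }) ∷ []) ∷ (adj⇒≢ wx ∷ []) ∷ [] ∷ []) _ _
    ; arc      = λ { Fin.zero → arc⁺ uv ; (Fin.suc Fin.zero) → arc⁺ vw
                   ; (Fin.suc (Fin.suc Fin.zero)) → arc⁺ wx
                   ; (Fin.suc (Fin.suc (Fin.suc Fin.zero))) → arc⁺ xu }
    }

  shortCycle? : NoShortWalk adj ⊎ (∃[ k ] (k ≤ 4 × DirectedCycle G k))
  shortCycle? with any? (λ u → any? λ v → (adj u v 𝔹.≟ true) ×-dec (adj v u 𝔹.≟ true))
  ... | yes (_ , _ , uv , vu) = inj₂ (2 , s≤s (s≤s z≤n) , 2-cycle uv vu)
  ... | no ¬2 with any? (λ u → any? λ v → any? λ w →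
                    (adj u v 𝔹.≟ true) ×-dec (adj v w 𝔹.≟ true) ×-dec (adj w u 𝔹.≟ true))
  ... | yes (_ , _ , _ , uv , vw , wu) = inj₂ (3 , s≤s (s≤s (s≤s z≤n)) , 3-cycle uv vw wu)
  ... | no ¬3 with any? (λ u → any? λ v → any? λ w → any? λ x →
                    (adj u v 𝔹.≟ true) ×-dec (adj v w 𝔹.≟ true) ×-dec
                    (adj w x 𝔹.≟ true) ×-dec (adj x u 𝔹.≟ true))
  ... | yes (_ , _ , _ , _ , uv , vw , wx , xu) =
    inj₂ (4 , ≤-refl , 4-cycle (λ uv vu → ¬2 (_ , _ , uv , vu)) uv vw wx xu)
  ... | no ¬4 = inj₁ record
    { no₁ = noLoop
    ; no₂ = λ uv vu → ¬2 (_ , _ , uv , vu)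
    ; no₃ = λ uv vw wu → ¬3 (_ , _ , _ , uv , vw , wu)
    ; no₄ = λ uv vw wx xu → ¬4 (_ , _ , _ , _ , uv , vw , wx , xu)
    }

-- From real to natural inequalities

-- If q < p, take m strictly between them; the choice ε = m - q gives p ≤ m < p.
≤+ε⇒≤ : ∀ {p q} → (∀ ε → ℚ.0ℚ ℚ.< ε → p ℚ.≤ q ℚ.+ ε) → p ℚ.≤ q
≤+ε⇒≤ {p} {q} h = ℚₚ.≮⇒≥ λ q<p → ℚₚ.<-irrefl refl (contradictory q<p)
  where
  open ℚₚ.≤-Reasoning
  contradictory : q ℚ.< p → p ℚ.< p
  contradictory q<p with ℚₚ.<-dense q<p
  ... | m , q<m , m<p = begin-strict
    p                        ≤⟨ h (m ℚ.- q) (begin-strict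
        ℚ.0ℚ       ≡⟨ ℚₚ.+-inverseʳ q ⟨
        q ℚ.- q    <⟨ ℚₚ.+-monoˡ-< (ℚ.- q) q<m ⟩
        m ℚ.- q    ∎) ⟩
    q ℚ.+ (m ℚ.- q)          ≡⟨ ℚₚ.+-comm q _ ⟩
    (m ℚ.- q) ℚ.+ q          ≡⟨ ℚₚ.+-assoc m (ℚ.- q) q ⟩
    m ℚ.+ (ℚ.- q ℚ.+ q)      ≡⟨ cong (m ℚ.+_) (ℚₚ.+-inverseˡ q) ⟩
    m ℚ.+ ℚ.0ℚ               ≡⟨ ℚₚ.+-identityʳ m ⟩
    m                        <⟨ m<p ⟩
    p                        ∎

-- At a common late index both comparisons hold up to δ. Scaling the first by `N` makes the total
-- error δ(1 + N), which can be any positive ε.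
≤ᴿ-scale : ∀ c α N d .{{_ : ℚ.NonNegative N}} →
  fromℚ c ≤ᴿ α → α *ᴿ fromℚ N ≤ᴿ fromℚ d → c ℚ.* N ℚ.≤ d
≤ᴿ-scale c α N d c≤α αN≤d = ≤+ε⇒≤ bound
  where
  open ℚₚ.≤-Reasoning

  approximate : ∀ δ → ℚ.0ℚ ℚ.< δ → c ℚ.* N ℚ.≤ d ℚ.+ (δ ℚ.+ δ ℚ.* N)
  approximate δ 0<δ with c≤α δ 0<δ | αN≤d δ 0<δ
  ... | K , hc | L , hα = begin
    c ℚ.* N                          ≤⟨ ℚₚ.*-monoʳ-≤-nonNeg N (hc (K ⊔ L) (m≤m⊔n K L)) ⟩
    (x ℚ.+ δ) ℚ.* N                  ≡⟨ ℚₚ.*-distribʳ-+ N x δ ⟩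
    x ℚ.* N ℚ.+ δ ℚ.* N              ≤⟨ ℚₚ.+-monoˡ-≤ (δ ℚ.* N) (hα (K ⊔ L) (m≤n⊔m K L)) ⟩
    d ℚ.+ δ ℚ.+ δ ℚ.* N              ≡⟨ ℚₚ.+-assoc d δ (δ ℚ.* N) ⟩
    d ℚ.+ (δ ℚ.+ δ ℚ.* N)            ∎
    where
    x : ℚ.ℚ
    x = seq α (K ⊔ L)

  bound : ∀ ε → ℚ.0ℚ ℚ.< ε → c ℚ.* N ℚ.≤ d ℚ.+ ε
  bound ε 0<ε = begin
    c ℚ.* N                    ≤⟨ approximate δ (ℚₚ.positive⁻¹ δ) ⟩
    d ℚ.+ (δ ℚ.+ δ ℚ.* N)      ≡⟨ cong (λ x → d ℚ.+ (x ℚ.+ δ ℚ.* N)) (ℚₚ.*-identityʳ δ) ⟨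
    d ℚ.+ (δ ℚ.* ℚ.1ℚ ℚ.+ δ ℚ.* N)
                               ≡⟨ cong (d ℚ.+_) (ℚₚ.*-distribˡ-+ δ ℚ.1ℚ N) ⟨
    d ℚ.+ δ ℚ.* M              ≡⟨ cong (d ℚ.+_) (ℚₚ.*-assoc ε (ℚ.1/ M) M) ⟩
    d ℚ.+ ε ℚ.* (ℚ.1/ M ℚ.* M) ≡⟨ cong (λ x → d ℚ.+ ε ℚ.* x) (ℚₚ.*-inverseˡ M) ⟩
    d ℚ.+ ε ℚ.* ℚ.1ℚ           ≡⟨ cong (d ℚ.+_) (ℚₚ.*-identityʳ ε) ⟩
    d ℚ.+ ε                    ∎
    where
    M : ℚ.ℚ
    M = ℚ.1ℚ ℚ.+ N
    instance
      M⁺ : ℚ.Positive M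
      M⁺ = ℚₚ.pos+nonNeg⇒pos ℚ.1ℚ N
      M≢0 : ℚ.NonZero M
      M≢0 = ℚₚ.pos⇒nonZero M
      1/M⁺ : ℚ.Positive (ℚ.1/ M)
      1/M⁺ = ℚₚ.1/pos⇒pos M
      ε⁺ : ℚ.Positive ε
      ε⁺ = ℚ.positive 0<ε
    δ : ℚ.ℚ
    δ = ε ℚ.* ℚ.1/ M
    instance
      δ⁺ : ℚ.Positive δ
      δ⁺ = ℚₚ.pos*pos⇒pos ε (ℚ.1/ M)

-- Normalised fractions hide numerator and denominator behind a gcd, so the inequality is moved to
-- unnormalised rationals and cross-multiplied there.
/-≤⇒*-≤ : ∀ a b n d → (+ a / suc b) ℚ.* (+ n / 1) ℚ.≤ + d / 1 → a * n ≤ suc b * d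
/-≤⇒*-≤ a b n d h = ℤₚ.drop‿+≤+ (subst₂ ℤ._≤_ left right (ℚᵘₚ.drop-*≤* unnormalised))
  where
  open ℚᵘₚ.≤-Reasoning
  unnormalised : ℚᵘ.mkℚᵘ (+ a) b ℚᵘ.* ℚᵘ.mkℚᵘ (+ n) 0 ℚᵘ.≤ ℚᵘ.mkℚᵘ (+ d) 0
  unnormalised = begin
    ℚᵘ.mkℚᵘ (+ a) b ℚᵘ.* ℚᵘ.mkℚᵘ (+ n) 0
      ≃⟨ ℚᵘₚ.*-cong (ℚₚ.toℚᵘ-fromℚᵘ (ℚᵘ.mkℚᵘ (+ a) b)) (ℚₚ.toℚᵘ-fromℚᵘ (ℚᵘ.mkℚᵘ (+ n) 0)) ⟨
    ℚ.toℚᵘ (+ a / suc b) ℚᵘ.* ℚ.toℚᵘ (+ n / 1)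
      ≃⟨ ℚₚ.toℚᵘ-homo-* (+ a / suc b) (+ n / 1) ⟨
    ℚ.toℚᵘ ((+ a / suc b) ℚ.* (+ n / 1))
      ≤⟨ ℚₚ.toℚᵘ-mono-≤ h ⟩
    ℚ.toℚᵘ (+ d / 1)
      ≃⟨ ℚₚ.toℚᵘ-fromℚᵘ (ℚᵘ.mkℚᵘ (+ d) 0) ⟩
    ℚᵘ.mkℚᵘ (+ d) 0 ∎
  left : + a ℤ.* + n ℤ.* + 1 ≡ + (a * n)
  left = trans (ℤₚ.*-identityʳ (+ a ℤ.* + n)) (sym (ℤₚ.pos-* a n))
  right : + d ℤ.* + (suc b * 1) ≡ + (suc b * d)
  right = trans (sym (ℤₚ.pos-* d (suc b * 1)))
                (cong +_ (trans (cong (d *_) (*-identityʳ (suc b))) (*-comm d (suc b))))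

-- From a rational outdegree bound to the real threshold

module _ {n} (G : Digraph n) (n>0 : 0 < n) (p s : ℕ) (p>0 : 0 < p)
  (dense : 2 * ((p + s) * (p + s) * (p + s)) + p * (p * (p + 2 * s)) <
           2 * p * (s * (p + s) + 3 * ((p + s) * (p + s))))
  (outdegrees : ∀ v → p * n ≤ (p + s) * Digraph.outdegree G v) where

  shortCycle : ∃[ k ] (k ≤ 4 × DirectedCycle G k)
  shortCycle with shortCycle? G
  ... | inj₂ cycle = cycle
  -- Inside the full vertex set all outneighbours are counted, so a sparse vertex violates
  -- `outdegrees`.
  ... | inj₁ short with sparseVertex (adj G) short p s p>0 dense n (λ _ → true)
                          (≤-reflexive (#-full n)) (subst (0 <_) (sym (#-full n)) n>0)
  ... | v , _ , few = ⊥-elim (<⇒≱ few (begin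
    p * # {n} (λ _ → true)           ≡⟨ cong (p *_) (#-full n) ⟩
    p * n                            ≤⟨ outdegrees v ⟩
    (p + s) * Digraph.outdegree G v  ≡⟨ cong ((p + s) *_) (#-subset (Digraph.out G v)) ⟨
    (p + s) * # (adj G v)            ∎))
    where
    open ≤-Reasoning

theorem1p2 : (α : ℝ) → fromℚ (+ 28866 / 100000) ≤ᴿ α →
    (n : ℕ) → 1 ≤ n → (G : Digraph n) →
    ((v : Fin n) → α *ᴿ fromℕ n ≤ᴿ fromℕ (Digraph.outdegree G v)) →
    ∃[ k ] (k ≤ 4 × DirectedCycle G k)
theorem1p2 α c≤α n n≥1 G hα =
  -- Here 71134 = 100000 - 28866, and `dense` is checked by evaluation: a(4 - 2a + a²/2) exceeds 1
  -- by about 0.000017. The 99999 below is the predecessor of the denominator.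
  shortCycle G n≥1 28866 71134 (s≤s z≤n) (<ᵇ⇒< _ _ tt) λ v →
    /-≤⇒*-≤ 28866 99999 n (Digraph.outdegree G v)
      (≤ᴿ-scale (+ 28866 / 100000) α (+ n / 1) (+ Digraph.outdegree G v / 1)
        {{ℚₚ.normalize-nonNeg n 1}} c≤α (hα v))
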